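{- If $n$ is a positive integer and $t$ is any integer, then $$\sum_{k=1}^n(-2)^{n-k}\frac{k}{n+k}\binom{n+k}{n-k}L_{5k+t}=\frac12\left(4^nF_{t+n+3}-F_{t-n+3}\right),$$ $$\sum_{k=1}^n(-2)^{n-k}\frac{k}{n+k}\binom{n+k}{n-k}F_{5k+t}=\frac1{10}\left(4^nL_{t+n+3}-L_{t-n+3}\right).$$
   Context: $F_n$ and $L_n$ ($n\in\mathbb{Z}$) are the Fibonacci and Lucas numbers: $F_0=0$, $F_1=1$, $F_n=F_{n-1}+F_{n-2}$; $L_0=2$, $L_1=1$, $L_n=L_{n-1}+L_{n-2}$, extended to negative indices by $F_{ -n}=(-1)^{n-1}F_n$, $L_{ -n}=(-1)^nL_n$. -}

module Defs where

open import Data.Fin.Base using (toℕ)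
open import Data.Integer.Base as ℤ using (ℤ; +_; -[1+_])
open import Data.Nat.Base as ℕ using (ℕ; zero; suc; NonZero)
open import Data.Nat.Combinatorics using (_C_)
open import Data.Rational.Base using (ℚ; _*_; _/_; +-0-rawMonoid)
open import Data.Rational.Literals using (fromℤ)

import Algebra.Definitions.RawMonoid +-0-rawMonoid as ℚ-Sum

fib : ℕ → ℕ
fib zero          = 0
fib (suc zero)    = 1
fib (suc (suc n)) = fib (suc n) ℕ.+ fib n

lucas : ℕ → ℕ
lucas zero          = 2
lucas (suc zero)    = 1
lucas (suc (suc n)) = lucas (suc n) ℕ.+ lucas n

-- As -[1+ m ] is -(m + 1), the negative clauses below are
-- F₋ₙ = (-1)ⁿ⁻¹ Fₙ and L₋ₙ = (-1)ⁿ Lₙ at n = m + 1.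

F : ℤ → ℤ
F (+ n)    = + fib n
F -[1+ m ] = ℤ.-1ℤ ℤ.^ m ℤ.* + fib (suc m)

L : ℤ → ℤ
L (+ n)    = + lucas n
L -[1+ m ] = ℤ.-1ℤ ℤ.^ suc m ℤ.* + lucas (suc m)

-- The index i : Fin n runs over 0, …, n - 1, so this is f 1 + … + f n.
sumFrom1 : (n : ℕ) → (ℕ → ℚ) → ℚ
sumFrom1 n f = ℚ-Sum.sum {n} (λ i → f (suc (toℕ i)))

syntax sumFrom1 n (λ k → e) = ∑[1≤ k ≤ n ] e

+-nonZeroˡ : ∀ m n .{{_ : NonZero m}} → NonZero (m ℕ.+ n)
+-nonZeroˡ (suc m) n = _

-- (-2)ⁿ⁻ᵏ · k / (n + k) · binom (n + k) (n - k).  The truncated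
-- subtraction is only meaningful for k ≤ n, the range of summation.
weight : (n k : ℕ) .{{_ : NonZero n}} → ℚ
weight n k =
  fromℤ ((ℤ.- (+ 2)) ℤ.^ (n ℕ.∸ k))
    * (+ k / (n ℕ.+ k))
    * fromℤ (+ ((n ℕ.+ k) C (n ℕ.∸ k)))
  where instance _ = +-nonZeroˡ n k

{-# OPTIONS --safe #-}
module Submission where

-- By absorption the k-th weight is half of (-2)ⁿ⁻ᵏ binom (n+k-1) (2k-1).  Let
-- A n t and B n t be the sums of (-2)ⁿ⁻ᵏ binom (n+k-1) (2k-1) G(5k+t) and of
-- (-2)ⁿ⁻ᵏ binom (n+k) (2k) G(5k+t).  Pascal's rule couples them (as for the
-- Morgan-Voyce polynomials):
--   A (n+1) t = -2 A n t + B n (t+5),   B (n+1) t = -2 B n t + A (n+1) t.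
-- If c G(m) = 2 H(m+1) - H(m) = H(m-1) + H(m+1) for a sequence H satisfying the
-- Fibonacci recurrence, induction on n gives
--   c A n t = 4ⁿ H(t+n+3) - H(t-n+3),   c B n t = 2 4ⁿ H(t+n+1) - H(t-n).
-- The theorem is the case (G, H, c) = (L, F, 1) and the case (F, L, 5).

open import Data.Fin.Base using (toℕ)
open import Data.Fin.Properties using (toℕ<n; toℕ-inject₁; toℕ-fromℕ)
open import Data.Integer.Base using (ℤ; +_; -[1+_]; _+_; _-_; _^_; -1ℤ; 0ℤ) renaming (_*_ to _·_)
import Data.Integer.Properties as ℤ
import Data.Integer.Tactic.RingSolver as ℤ-Solver
open import Data.Nat.Base as ℕ using (ℕ; NonZero; zero; suc; _∸_; _≤_; _<_)
open import Data.Nat.Combinatorics using (_C_; nCk+nC[k+1]≡[n+1]C[k+1]; k>n⇒nCk≡0; nCk≡nC[n∸k]; nC1≡n)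
import Data.Nat.Properties as ℕ
import Data.Nat.Tactic.RingSolver as ℕ-Solver
open import Data.Product.Base using (_×_; _,_; proj₁; proj₂)
open import Data.Rational.Base using (_*_; _/_; ½; toℚᵘ)
import Data.Rational.Base as ℚ
open import Data.Rational.Literals using (fromℤ)
import Data.Rational.Properties as ℚ
open import Data.Rational.Unnormalised.Base as ℚᵘ using (mkℚᵘ; *≡*)
import Data.Rational.Unnormalised.Properties as ℚᵘ
open import Relation.Binary.PropositionalEquality using (_≡_; refl; sym; trans; cong; cong₂; subst; module ≡-Reasoning)
open import Relation.Nullary.Decidable.Core using (yes; no)
open import Defs

open import Algebra.Bundles using (CommutativeRing)
import Algebra.Properties.Group (CommutativeRing.+-group ℤ.+-*-commutativeRing) as ℤ-Group
import Algebra.Properties.Semiring.Sum as Sum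
private
  module ∑ℤ = Sum ℤ.+-*-semiring
  module ∑ℚ = Sum (CommutativeRing.semiring ℚ.+-*-commutativeRing)

-- Fibonacci and Lucas numbers with integer index

IsGibonacci : (ℤ → ℤ) → Set
IsGibonacci H = ∀ m → H (+ 2 + m) ≡ H (+ 1 + m) + H m

F-gibonacci : IsGibonacci F
F-gibonacci (+ n) = refl
-- At -1 and -2 the three indices straddle zero, where the two clauses of `F` meet, and the values
-- are compared numerically. From -3 on all three are negative and, signs aside, the natural-number
-- recurrence is read backwards.
F-gibonacci -[1+ 0 ] = refl
F-gibonacci -[1+ 1 ] = refl
F-gibonacci -[1+ suc (suc m) ] =
  lemma (-1ℤ ^ m) (+ fib (suc (suc m))) (+ fib (suc m))
  where
  lemma : ∀ s x y → s · y ≡ -1ℤ · s · x + -1ℤ · (-1ℤ · s) · (x + y)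
  lemma = ℤ-Solver.solve-∀

L-gibonacci : IsGibonacci L
L-gibonacci (+ n) = refl
L-gibonacci -[1+ 0 ] = refl
L-gibonacci -[1+ 1 ] = refl
L-gibonacci -[1+ suc (suc m) ] =
  lemma (-1ℤ ^ suc m) (+ lucas (suc (suc m))) (+ lucas (suc m))
  where
  lemma : ∀ s x y → s · y ≡ -1ℤ · s · x + -1ℤ · (-1ℤ · s) · (x + y)
  lemma = ℤ-Solver.solve-∀

module _ {G H : ℤ → ℤ} (G-gib : IsGibonacci G) (H-gib : IsGibonacci H)
         (eq₀ : G (+ 0) ≡ H (+ 0)) (eq₁ : G (+ 1) ≡ H (+ 1)) where

  private
    upwards : ∀ n → G (+ n) ≡ H (+ n) × G (+ suc n) ≡ H (+ suc n)
    upwards zero = eq₀ , eq₁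
    upwards (suc n) with upwards n
    ... | e₀ , e₁ = e₁ ,
      trans (G-gib (+ n)) (trans (cong₂ _+_ e₁ e₀) (sym (H-gib (+ n))))

    downstep : ∀ m → G (+ 1 + m) ≡ H (+ 1 + m) → G (+ 2 + m) ≡ H (+ 2 + m) → G m ≡ H m
    downstep m e₁ e₂ = ℤ-Group.∙-cancelˡ (G (+ 1 + m)) (G m) (H m) (begin
      G (+ 1 + m) + G m  ≡⟨ G-gib m ⟨
      G (+ 2 + m)        ≡⟨ e₂ ⟩
      H (+ 2 + m)        ≡⟨ H-gib m ⟩
      H (+ 1 + m) + H m  ≡⟨ cong (_+ H m) e₁ ⟨
      G (+ 1 + m) + H m  ∎)
      where open ≡-Reasoning

    downwards : ∀ m → G -[1+ m ] ≡ H -[1+ m ] × G -[1+ suc m ] ≡ H -[1+ suc m ]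
    downwards zero = e₋₁ , downstep -[1+ 1 ] e₋₁ eq₀
      where e₋₁ = downstep -[1+ 0 ] eq₀ eq₁
    downwards (suc m) with downwards m
    ... | e₀ , e₁ = e₁ , downstep -[1+ suc (suc m) ] e₁ e₀

  -- The recurrence run forwards fixes the values at nonnegative indices; run backwards, by
  -- cancelling the middle term in `downstep`, it fixes the negative ones. It has order two, so both
  -- inductions carry two consecutive values.
  gibonacci-unique : ∀ m → G m ≡ H m
  gibonacci-unique (+ n)    = proj₁ (upwards n)
  gibonacci-unique -[1+ m ] = proj₁ (downwards m)

module _ (H : ℤ → ℤ) (H-gib : IsGibonacci H) where

  gibonacci-scale : ∀ c → IsGibonacci (λ m → c · H m)
  gibonacci-scale c m = trans (cong (c ·_) (H-gib m)) (ℤ.*-distribˡ-+ c _ _)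

  -- A linear combination of shifts of `H` inherits its recurrence. For `H = F` it gives the Lucas
  -- numbers, for `H = L` five times the Fibonacci numbers.
  gibonacci-companion : IsGibonacci (λ m → + 2 · H (+ 1 + m) - H m)
  gibonacci-companion m = begin
    + 2 · H (+ 1 + (+ 2 + m)) - H (+ 2 + m)
      ≡⟨ cong₂ (λ i x → + 2 · H i - x) (swap m) (H-gib m) ⟩
    + 2 · H (+ 2 + (+ 1 + m)) - (H (+ 1 + m) + H m)
      ≡⟨ cong (λ x → + 2 · x - (H (+ 1 + m) + H m)) (H-gib (+ 1 + m)) ⟩
    + 2 · (H (+ 1 + (+ 1 + m)) + H (+ 1 + m)) - (H (+ 1 + m) + H m)
      ≡⟨ regroup (H (+ 1 + (+ 1 + m))) (H (+ 1 + m)) (H m) ⟩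
    + 2 · H (+ 1 + (+ 1 + m)) - H (+ 1 + m) + (+ 2 · H (+ 1 + m) - H m) ∎
    where
    open ≡-Reasoning
    swap : ∀ m → + 1 + (+ 2 + m) ≡ + 2 + (+ 1 + m)
    swap = ℤ-Solver.solve-∀
    regroup : ∀ x y z → + 2 · (x + y) - (y + z) ≡ + 2 · x - y + (+ 2 · y - z)
    regroup = ℤ-Solver.solve-∀

-- This addition formula expresses values of `H` near `m` through `H (+ 1 + m)` and `H m` alone. For
-- a concrete `k` the coefficients are numerals, so that identities between such values become ring
-- identities.
gibonacci-shift : ∀ {H} → IsGibonacci H → ∀ k m →
  H (+ suc k + m) ≡ + fib (suc k) · H (+ 1 + m) + + fib k · H m
gibonacci-shift {H} H-gib k m = proj₁ (go k)
  where
  Shift : ℕ → Set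
  Shift k = H (+ suc k + m) ≡ + fib (suc k) · H (+ 1 + m) + + fib k · H m
  base₁ : ∀ x y → x ≡ + 1 · x + + 0 · y
  base₁ = ℤ-Solver.solve-∀
  base₂ : ∀ x y → x + y ≡ + 1 · x + + 1 · y
  base₂ = ℤ-Solver.solve-∀
  collect : ∀ a b x y → (a + b) · x + a · y + (a · x + b · y) ≡ (a + b + a) · x + (a + b) · y
  collect = ℤ-Solver.solve-∀
  go : ∀ k → Shift k × Shift (suc k)
  go zero = base₁ (H (+ 1 + m)) (H m) , trans (H-gib m) (base₂ (H (+ 1 + m)) (H m))
  go (suc k) with go k
  ... | e₀ , e₁ = e₁ , (begin
    H (+ 2 + + suc k + m)             ≡⟨ cong H (ℤ.+-assoc (+ 2) (+ suc k) m) ⟩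
    H (+ 2 + (+ suc k + m))           ≡⟨ H-gib (+ suc k + m) ⟩
    H (+ 1 + (+ suc k + m)) + H (+ suc k + m)
      ≡⟨ cong (λ i → H i + H (+ suc k + m)) (ℤ.+-assoc (+ 1) (+ suc k) m) ⟨
    H (+ suc (suc k) + m) + H (+ suc k + m)
      ≡⟨ cong₂ _+_ e₁ e₀ ⟩
    _ ≡⟨ collect (+ fib (suc k)) (+ fib k) (H (+ 1 + m)) (H m) ⟩
    + fib (suc (suc (suc k))) · H (+ 1 + m) + + fib (suc (suc k)) · H m ∎)
    where open ≡-Reasoning

-- Both sides satisfy the recurrence and agree at 0 and 1: 2 = 2·1 - 0 and 1 = 2·1 - 1.
L-via-F : ∀ m → L m ≡ + 2 · F (+ 1 + m) - F m
L-via-F = gibonacci-unique L-gibonacci (gibonacci-companion F F-gibonacci) refl refl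

5F-via-L : ∀ m → + 5 · F m ≡ + 2 · L (+ 1 + m) - L m
5F-via-L = gibonacci-unique (gibonacci-scale F F-gibonacci (+ 5))
  (gibonacci-companion L L-gibonacci) refl refl

-- Binomial coefficients

-- Induction along Pascal's rule. One copy of `x` is split off from `suc (suc k)` copies, so that
-- the induction hypothesis applies at `k` to the rest and at `suc k` to the other summand; Pascal's
-- rule then recombines the results.
absorption : ∀ n k → suc k ℕ.* (suc n C suc k) ≡ suc n ℕ.* (n C k)
absorption n zero = trans (ℕ.*-identityˡ _) (trans (nC1≡n (suc n)) (sym (ℕ.*-identityʳ (suc n))))
absorption zero (suc k) = trans
  (cong (suc (suc k) ℕ.*_) (k>n⇒nCk≡0 {1} {suc (suc k)} (ℕ.s≤s (ℕ.s≤s ℕ.z≤n))))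
  (ℕ.*-zeroʳ (suc (suc k)))
absorption (suc n) (suc k) = begin
  suc (suc k) ℕ.* (suc (suc n) C suc (suc k))
    ≡⟨ cong (suc (suc k) ℕ.*_) (nCk+nC[k+1]≡[n+1]C[k+1] (suc n) (suc k)) ⟨
  suc (suc k) ℕ.* (x ℕ.+ (suc n C suc (suc k)))
    ≡⟨ ℕ.*-distribˡ-+ (suc (suc k)) x _ ⟩
  (x ℕ.+ suc k ℕ.* x) ℕ.+ suc (suc k) ℕ.* (suc n C suc (suc k))
    ≡⟨ cong₂ (λ u v → x ℕ.+ u ℕ.+ v) (absorption n k) (absorption n (suc k)) ⟩
  x ℕ.+ suc n ℕ.* (n C k) ℕ.+ suc n ℕ.* (n C suc k)
    ≡⟨ ℕ.+-assoc x _ _ ⟩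
  x ℕ.+ (suc n ℕ.* (n C k) ℕ.+ suc n ℕ.* (n C suc k))
    ≡⟨ cong (x ℕ.+_) (ℕ.*-distribˡ-+ (suc n) (n C k) (n C suc k)) ⟨
  x ℕ.+ suc n ℕ.* ((n C k) ℕ.+ (n C suc k))
    ≡⟨ cong (λ u → x ℕ.+ suc n ℕ.* u) (nCk+nC[k+1]≡[n+1]C[k+1] n k) ⟩
  suc (suc n) ℕ.* x ∎
  where
  open ≡-Reasoning
  x = suc n C suc k

-- Coefficients of the two sums and Pascal's rule

k*2≡k+k : ∀ k → k ℕ.* 2 ≡ k ℕ.+ k
k*2≡k+k = ℕ-Solver.solve-∀

-2ℤ : ℤ
-2ℤ = -[1+ 1 ]

-- At k = i + 1, odd n i is (-2)ⁿ⁻ᵏ · binom (n + k - 1) (2k - 1).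
odd : ℕ → ℕ → ℤ
odd n i = -2ℤ ^ (n ∸ suc i) · + ((n ℕ.+ i) C suc (i ℕ.* 2))

-- The factor 2 stands on the right because `suc k * 2` reduces to `suc (suc (k * 2))`, the shape
-- that Pascal's rule needs.
even : ℕ → ℕ → ℤ
even n k = -2ℤ ^ (n ∸ k) · + ((n ℕ.+ k) C (k ℕ.* 2))

even-vanishes : ∀ {n k} → n < k → (n ℕ.+ k) C (k ℕ.* 2) ≡ 0
even-vanishes {n} {k} n<k = k>n⇒nCk≡0
  (subst (n ℕ.+ k <_) (sym (k*2≡k+k k)) (ℕ.+-monoˡ-< k n<k))

odd-vanishes : ∀ {n i} → n < suc i → (n ℕ.+ i) C suc (i ℕ.* 2) ≡ 0
odd-vanishes {n} {i} n<1+i = k>n⇒nCk≡0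
  (subst (λ j → n ℕ.+ i < suc j) (sym (k*2≡k+k i)) (ℕ.+-monoˡ-< i n<1+i))

-- For `k ≤ n` one factor `q` splits off. Beyond that range truncated subtraction gives the wrong
-- exponent, but there the binomial coefficient `x` is zero and so are both sides.
^-suc-∸ : ∀ q n k {x} → (n < k → x ≡ 0) → q ^ (suc n ∸ k) · + x ≡ q · (q ^ (n ∸ k) · + x)
^-suc-∸ q n k {x} vanishes with k ℕ.≤? n
... | yes k≤n rewrite ℕ.+-∸-assoc 1 k≤n = ℤ.*-assoc q (q ^ (n ∸ k)) (+ x)
... | no  k≰n rewrite vanishes (ℕ.≰⇒> k≰n)
                    | ℤ.*-zeroʳ (q ^ (n ∸ k)) | ℤ.*-zeroʳ q = ℤ.*-zeroʳ (q ^ (suc n ∸ k))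

-- Pascal's rule on the upper index. As `suc n ∸ suc i` reduces to `n ∸ i`, one summand already
-- carries the power belonging to `even n i`; the other needs one more factor -2.
odd-suc : ∀ n i → odd (suc n) i ≡ -2ℤ · odd n i + even n i
odd-suc n i = begin
  p · + (suc (n ℕ.+ i) C suc (i ℕ.* 2))
    ≡⟨ cong (λ z → p · + z) (nCk+nC[k+1]≡[n+1]C[k+1] (n ℕ.+ i) (i ℕ.* 2)) ⟨
  p · (+ x + + y)                  ≡⟨ ℤ.*-distribˡ-+ p (+ x) (+ y) ⟩
  even n i + p · + y               ≡⟨ ℤ.+-comm (even n i) _ ⟩
  p · + y + even n i               ≡⟨ cong (_+ even n i) (^-suc-∸ -2ℤ n (suc i) odd-vanishes) ⟩
  -2ℤ · odd n i + even n i    ∎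
  where
  open ≡-Reasoning
  p = -2ℤ ^ (n ∸ i)
  x = (n ℕ.+ i) C (i ℕ.* 2)
  y = (n ℕ.+ i) C suc (i ℕ.* 2)

even-suc-zero : ∀ n → even (suc n) 0 ≡ -2ℤ · even n 0
even-suc-zero n = ^-suc-∸ -2ℤ n 0 λ ()

even-suc-suc : ∀ n k → even (suc n) (suc k) ≡ -2ℤ · even n (suc k) + odd (suc n) k
even-suc-suc n k = begin
  p · + (suc (n ℕ.+ suc k) C suc (suc (k ℕ.* 2)))
    ≡⟨ cong (λ z → p · + z) (nCk+nC[k+1]≡[n+1]C[k+1] (n ℕ.+ suc k) (suc (k ℕ.* 2))) ⟨
  p · (+ x + + y)                  ≡⟨ ℤ.*-distribˡ-+ p (+ x) (+ y) ⟩
  p · + x + p · + y                ≡⟨ ℤ.+-comm (p · + x) _ ⟩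
  p · + y + p · + x
    ≡⟨ cong₂ _+_ (^-suc-∸ -2ℤ n (suc k) (even-vanishes {n} {suc k}))
         (cong (λ z → p · + (z C suc (k ℕ.* 2))) (ℕ.+-suc n k)) ⟩
  -2ℤ · even n (suc k) + odd (suc n) k ∎
  where
  open ≡-Reasoning
  p = -2ℤ ^ (n ∸ k)
  x = (n ℕ.+ suc k) C suc (k ℕ.* 2)
  y = (n ℕ.+ suc k) C suc (suc (k ℕ.* 2))

-- The recurrences for the sums

sumBelow : ℕ → (ℕ → ℤ) → ℤ
sumBelow n f = ∑ℤ.sum {n} (λ i → f (toℕ i))

sumBelow-snoc : ∀ n f → sumBelow (suc n) f ≡ sumBelow n f + f n
sumBelow-snoc n f = trans (∑ℤ.sum-init-last {n} (λ i → f (toℕ i)))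
  (cong₂ _+_ (∑ℤ.sum-cong-≗ {n} (λ i → cong f (toℕ-inject₁ i))) (cong f (toℕ-fromℕ n)))

sumBelow-snoc-0 : ∀ n f → f n ≡ 0ℤ → sumBelow (suc n) f ≡ sumBelow n f
sumBelow-snoc-0 n f fn≡0 = trans (sumBelow-snoc n f)
  (trans (cong (λ x → sumBelow n f + x) fn≡0) (ℤ.+-identityʳ _))

sumBelow-linear : ∀ n q (f g h : ℕ → ℤ) → (∀ i → h i ≡ q · f i + g i) →
  sumBelow n h ≡ q · sumBelow n f + sumBelow n g
sumBelow-linear n q f g h h≡qf+g = begin
  sumBelow n h
    ≡⟨ ∑ℤ.sum-cong-≗ {n} (λ i → h≡qf+g (toℕ i)) ⟩
  sumBelow n (λ i → q · f i + g i)
    ≡⟨ ∑ℤ.∑-distrib-+ {n} (λ i → q · f (toℕ i)) (λ i → g (toℕ i)) ⟩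
  sumBelow n (λ i → q · f i) + sumBelow n g
    ≡⟨ cong (_+ sumBelow n g) (∑ℤ.*-distribˡ-sum {n} q (λ i → f (toℕ i))) ⟨
  q · sumBelow n f + sumBelow n g ∎
  where open ≡-Reasoning

-- The sums A and B of the overview. `oddSum` is indexed by i = k - 1; `evenSum` also has the term k
-- = 0, hence `suc n` terms.
oddSum evenSum : (ℤ → ℤ) → ℕ → ℤ → ℤ
oddSum G n t = sumBelow n (λ i → odd n i · G (+ 5 · + suc i + t))
evenSum G n t = sumBelow (suc n) (λ k → even n k · G (+ 5 · + k + t))

module _ (G : ℤ → ℤ) where
  open ≡-Reasoning

  -- The shift of `t` by 5 compensates for the index i = k - 1 of `oddSum`. The surplus term at i =
  -- n vanishes with its binomial coefficient.
  oddSum-suc : ∀ n t → oddSum G (suc n) t ≡ -2ℤ · oddSum G n t + evenSum G n (+ 5 + t)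
  oddSum-suc n t = begin
    oddSum G (suc n) t
      ≡⟨ sumBelow-linear (suc n) -2ℤ f g _ step ⟩
    -2ℤ · sumBelow (suc n) f + evenSum G n (+ 5 + t)
      ≡⟨ cong (λ z → -2ℤ · z + evenSum G n (+ 5 + t)) (sumBelow-snoc-0 n f last-vanishes) ⟩
    -2ℤ · oddSum G n t + evenSum G n (+ 5 + t) ∎
    where
    f g : ℕ → ℤ
    f i = odd n i · G (+ 5 · + suc i + t)
    g k = even n k · G (+ 5 · + k + (+ 5 + t))
    index : ∀ k t → + 5 · (+ 1 + k) + t ≡ + 5 · k + (+ 5 + t)
    index = ℤ-Solver.solve-∀
    distrib : ∀ q a b x → (q · a + b) · x ≡ q · (a · x) + b · x
    distrib = ℤ-Solver.solve-∀
    step : ∀ i → odd (suc n) i · G (+ 5 · + suc i + t) ≡ -2ℤ · f i + g i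
    step i = begin
      odd (suc n) i · x                          ≡⟨ cong (_· x) (odd-suc n i) ⟩
      (-2ℤ · odd n i + even n i) · x        ≡⟨ distrib -2ℤ (odd n i) (even n i) x ⟩
      -2ℤ · f i + even n i · x
        ≡⟨ cong (λ m → -2ℤ · f i + even n i · G m) (index (+ i) t) ⟩
      -2ℤ · f i + g i ∎
      where x = G (+ 5 · + suc i + t)
    last-vanishes : f n ≡ 0ℤ
    last-vanishes rewrite odd-vanishes {n} {n} ℕ.≤-refl
                        | ℤ.*-zeroʳ (-2ℤ ^ (n ∸ suc n)) = refl

  -- The term k = 0 has no odd partner and is split off; the terms k = i + 1 pair with the terms i
  -- of `oddSum`. The surplus term at k = n + 1 vanishes.
  evenSum-suc : ∀ n t → evenSum G (suc n) t ≡ -2ℤ · evenSum G n t + oddSum G (suc n) t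
  evenSum-suc n t = begin
    even (suc n) 0 · x₀ + sumBelow (suc n) (λ k → even (suc n) (suc k) · x k)
      ≡⟨ cong₂ _+_ (cong (_· x₀) (even-suc-zero n))
           (sumBelow-linear (suc n) -2ℤ (λ k → f (suc k)) g _ step) ⟩
    -2ℤ · even n 0 · x₀ + (-2ℤ · sumBelow (suc n) (λ k → f (suc k)) + oddSum G (suc n) t)
      ≡⟨ regroup -2ℤ (even n 0) x₀ (sumBelow (suc n) (λ k → f (suc k))) (oddSum G (suc n) t) ⟩
    -2ℤ · sumBelow (suc (suc n)) f + oddSum G (suc n) t
      ≡⟨ cong (λ z → -2ℤ · z + oddSum G (suc n) t) (sumBelow-snoc-0 (suc n) f last-vanishes) ⟩
    -2ℤ · evenSum G n t + oddSum G (suc n) t ∎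
    where
    x : ℕ → ℤ
    x k = G (+ 5 · + suc k + t)
    x₀ = G (+ 5 · + 0 + t)
    f g : ℕ → ℤ
    f k = even n k · G (+ 5 · + k + t)
    g k = odd (suc n) k · x k
    regroup : ∀ q a y s o → q · a · y + (q · s + o) ≡ q · (a · y + s) + o
    regroup = ℤ-Solver.solve-∀
    distrib : ∀ q a b y → (q · a + b) · y ≡ q · (a · y) + b · y
    distrib = ℤ-Solver.solve-∀
    step : ∀ k → even (suc n) (suc k) · x k ≡ -2ℤ · f (suc k) + g k
    step k = trans (cong (_· x k) (even-suc-suc n k))
      (distrib -2ℤ (even n (suc k)) (odd (suc n) k) (x k))
    last-vanishes : f (suc n) ≡ 0ℤ
    last-vanishes rewrite even-vanishes {n} {suc n} ℕ.≤-refl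
                        | ℤ.*-zeroʳ (-2ℤ ^ (n ∸ suc n)) = refl

-- Closed forms of the two sums

module ClosedForm {G H : ℤ → ℤ} (c : ℤ) (H-gib : IsGibonacci H)
         (G-via-H : ∀ m → c · G m ≡ + 2 · H (+ 1 + m) - H m) where
  open ≡-Reasoning

  OddClosed EvenClosed : ℕ → ℤ → Set
  OddClosed n t = c · oddSum G n t ≡ (+ 4) ^ n · H (t + + n + + 3) - H (t - + n + + 3)
  EvenClosed n t = c · evenSum G n t ≡ + 2 · ((+ 4) ^ n · H (t + + n + + 1)) - H (t - + n)

  private
    shift : ∀ k {i} m → i ≡ + suc k + m → H i ≡ + fib (suc k) · H (+ 1 + m) + + fib k · H m
    shift k m refl = gibonacci-shift H-gib k m

    distrib : ∀ c q a b → c · (q · a + b) ≡ q · (c · a) + c · b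
    distrib = ℤ-Solver.solve-∀

  oddClosed-zero : ∀ t → OddClosed 0 t
  -- The sum is empty, and `t - + 0` reduces to `t + + 0`, so the two values of `H` cancel.
  oddClosed-zero t rewrite ℤ.*-zeroʳ c = lemma (H (t + + 0 + + 3))
    where
    lemma : ∀ x → + 0 ≡ + 1 · x - x
    lemma = ℤ-Solver.solve-∀

  evenClosed-zero : ∀ t → EvenClosed 0 t
  evenClosed-zero t = begin
    c · (+ 1 · G (+ 0 + t) + + 0)
      ≡⟨ cong (c ·_) (trans (ℤ.+-identityʳ _) (ℤ.*-identityˡ _)) ⟩
    c · G (+ 0 + t)                        ≡⟨ cong (λ i → c · G i) (ℤ.+-identityˡ t) ⟩
    c · G t                                ≡⟨ G-via-H t ⟩
    + 2 · H (+ 1 + t) - H t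
      ≡⟨ cong₂ (λ i j → + 2 · i - H j)
           (trans (sym (ℤ.*-identityˡ _)) (cong (λ i → + 1 · H i) (index₁ t))) (index₂ t) ⟩
    + 2 · (+ 1 · H (t + + 0 + + 1)) - H (t - + 0) ∎
    where
    index₁ : ∀ t → + 1 + t ≡ t + + 0 + + 1
    index₁ = ℤ-Solver.solve-∀
    index₂ : ∀ t → t ≡ t - + 0
    index₂ = ℤ-Solver.solve-∀

  oddClosed-suc : ∀ n t → OddClosed n t → EvenClosed n (+ 5 + t) → OddClosed (suc n) t
  oddClosed-suc n t eqᵒ eqᵉ = begin
    c · oddSum G (suc n) t
      ≡⟨ cong (c ·_) (oddSum-suc G n t) ⟩
    c · (-2ℤ · oddSum G n t + evenSum G n (+ 5 + t))
      ≡⟨ distrib c -2ℤ (oddSum G n t) (evenSum G n (+ 5 + t)) ⟩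
    -2ℤ · (c · oddSum G n t) + c · evenSum G n (+ 5 + t)
      ≡⟨ cong₂ (λ i j → -2ℤ · i + j) eqᵒ eqᵉ ⟩
    -2ℤ · (p · H (t + + n + + 3) - H (t - + n + + 3))
      + (+ 2 · (p · H (+ 5 + t + + n + + 1)) - H (+ 5 + t - + n))
      -- Every value of `H` is reduced to neighbours at `u` and `v`. The numerals in `identity` are
      -- the Fibonacci coefficients so produced, and the four remaining values are treated as free
      -- variables.
      ≡⟨ cong₂ (λ i j → -2ℤ · (p · proj₁ i - proj₂ i) + (+ 2 · (p · proj₁ j) - proj₂ j))
           (cong₂ _,_ (shift 2 u (i₁ t (+ n))) (shift 2 v (i₂ t (+ n))))
           (cong₂ _,_ (shift 5 u (i₃ t (+ n))) (shift 4 v (i₄ t (+ n)))) ⟩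
    _ ≡⟨ identity p (H (+ 1 + u)) (H u) (H (+ 1 + v)) (H v) ⟩
    _ ≡⟨ cong₂ (λ i j → (+ 4) ^ suc n · i - j) (shift 3 u (i₅ t (+ n))) (shift 1 v (i₆ t (+ n))) ⟨
    (+ 4) ^ suc n · H (t + + suc n + + 3) - H (t - + suc n + + 3) ∎
    where
    p = (+ 4) ^ n
    u = t + + n
    v = t - + n
    i₁ : ∀ t n → t + n + + 3 ≡ + 3 + (t + n)
    i₁ = ℤ-Solver.solve-∀
    i₂ : ∀ t n → t - n + + 3 ≡ + 3 + (t - n)
    i₂ = ℤ-Solver.solve-∀
    i₃ : ∀ t n → + 5 + t + n + + 1 ≡ + 6 + (t + n)
    i₃ = ℤ-Solver.solve-∀
    i₄ : ∀ t n → + 5 + t - n ≡ + 5 + (t - n)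
    i₄ = ℤ-Solver.solve-∀
    i₅ : ∀ t n → t + (+ 1 + n) + + 3 ≡ + 4 + (t + n)
    i₅ = ℤ-Solver.solve-∀
    i₆ : ∀ t n → t - (+ 1 + n) + + 3 ≡ + 2 + (t - n)
    i₆ = ℤ-Solver.solve-∀
    identity : ∀ p u₁ u₀ v₁ v₀ →
      -[1+ 1 ] · (p · (+ 2 · u₁ + + 1 · u₀) - (+ 2 · v₁ + + 1 · v₀))
        + (+ 2 · (p · (+ 8 · u₁ + + 5 · u₀)) - (+ 5 · v₁ + + 3 · v₀))
      ≡ + 4 · p · (+ 3 · u₁ + + 2 · u₀) - (+ 1 · v₁ + + 1 · v₀)
    identity = ℤ-Solver.solve-∀

  evenClosed-suc : ∀ n t → OddClosed (suc n) t → EvenClosed n t → EvenClosed (suc n) t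
  evenClosed-suc n t eqᵒ eqᵉ = begin
    c · evenSum G (suc n) t
      ≡⟨ cong (c ·_) (evenSum-suc G n t) ⟩
    c · (-2ℤ · evenSum G n t + oddSum G (suc n) t)
      ≡⟨ distrib c -2ℤ (evenSum G n t) (oddSum G (suc n) t) ⟩
    -2ℤ · (c · evenSum G n t) + c · oddSum G (suc n) t
      ≡⟨ cong₂ (λ i j → -2ℤ · i + j) eqᵉ eqᵒ ⟩
    -2ℤ · (+ 2 · (p · H (t + + n + + 1)) - H (t - + n))
      + ((+ 4) ^ suc n · H (t + + suc n + + 3) - H (t - + suc n + + 3))
      ≡⟨ cong₂ (λ i j → -2ℤ · (+ 2 · (p · proj₁ i) - proj₂ i) + ((+ 4) ^ suc n · proj₁ j - proj₂ j))
           (cong₂ _,_ (cong H (i₁ t (+ n))) (cong H (i₂ t (+ n))))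
           (cong₂ _,_ (shift 3 u (i₃ t (+ n))) (shift 2 v (i₄ t (+ n)))) ⟩
    _ ≡⟨ identity p (H (+ 1 + u)) (H u) (H (+ 1 + v)) (H v) ⟩
    _ ≡⟨ cong (λ i → + 2 · ((+ 4) ^ suc n · i) - H v) (shift 1 u (i₅ t (+ n))) ⟨
    + 2 · ((+ 4) ^ suc n · H (t + + suc n + + 1)) - H (t - + suc n) ∎
    where
    p = (+ 4) ^ n
    u = t + + n
    -- This is the lowest index on the downward side, so all offsets from it are nonnegative.
    v = t - + suc n
    i₁ : ∀ t n → t + n + + 1 ≡ + 1 + (t + n)
    i₁ = ℤ-Solver.solve-∀
    i₂ : ∀ t n → t - n ≡ + 1 + (t - (+ 1 + n))
    i₂ = ℤ-Solver.solve-∀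
    i₃ : ∀ t n → t + (+ 1 + n) + + 3 ≡ + 4 + (t + n)
    i₃ = ℤ-Solver.solve-∀
    i₄ : ∀ t n → t - (+ 1 + n) + + 3 ≡ + 3 + (t - (+ 1 + n))
    i₄ = ℤ-Solver.solve-∀
    i₅ : ∀ t n → t + (+ 1 + n) + + 1 ≡ + 2 + (t + n)
    i₅ = ℤ-Solver.solve-∀
    identity : ∀ p u₁ u₀ v₁ v₀ →
      -[1+ 1 ] · (+ 2 · (p · u₁) - v₁)
        + (+ 4 · p · (+ 3 · u₁ + + 2 · u₀) - (+ 2 · v₁ + + 1 · v₀))
      ≡ + 2 · (+ 4 · p · (+ 1 · u₁ + + 1 · u₀)) - v₀
    identity = ℤ-Solver.solve-∀

  -- The odd case at `suc n` uses the even case at `n` with `+ 5 + t`, so the induction must hold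
  -- for all `t`; the even case at `suc n` uses the odd case just obtained.
  closedForm : ∀ n t → OddClosed n t × EvenClosed n t
  closedForm zero t = oddClosed-zero t , evenClosed-zero t
  closedForm (suc n) t = eqᵒ , evenClosed-suc n t eqᵒ (proj₂ (closedForm n t))
    where eqᵒ = oddClosed-suc n t (proj₁ (closedForm n t)) (proj₂ (closedForm n (+ 5 + t)))

-- Passage to the rationals

toℚᵘ-/ : ∀ i d .{{_ : NonZero d}} → toℚᵘ (i / d) ℚᵘ.≃ i ℚᵘ./ d
toℚᵘ-/ i (suc d) = ℚ.toℚᵘ-fromℚᵘ (mkℚᵘ i d)

fromℤ-+ : ∀ i j → fromℤ (i + j) ≡ fromℤ i ℚ.+ fromℤ j
fromℤ-+ i j = ℚ.toℚᵘ-injective (ℚᵘ.≃-trans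
  (*≡* (cong (_· + 1) (sym (cong₂ _+_ (ℤ.*-identityʳ i) (ℤ.*-identityʳ j)))))
  (ℚᵘ.≃-sym (ℚ.toℚᵘ-homo-+ (fromℤ i) (fromℤ j))))

fromℤ-* : ∀ i j → fromℤ (i · j) ≡ fromℤ i * fromℤ j
fromℤ-* i j = ℚ.toℚᵘ-injective (ℚᵘ.≃-sym (ℚ.toℚᵘ-homo-* (fromℤ i) (fromℤ j)))

fromℤ-sumBelow : ∀ n f → fromℤ (sumBelow n f) ≡ ∑ℚ.sum {n} (λ i → fromℤ (f (toℕ i)))
fromℤ-sumBelow zero f = refl
fromℤ-sumBelow (suc n) f = trans (fromℤ-+ (f 0) _)
  (cong (fromℤ (f 0) ℚ.+_) (fromℤ-sumBelow n (λ i → f (suc i))))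

-- Since `_/_` cancels common factors, it does not reduce for variable arguments. Over unnormalised
-- rationals equality is cross-multiplication, which here is the hypothesis.
/-*-halve : ∀ k d x y .{{_ : NonZero d}} → 2 ℕ.* k ℕ.* x ≡ d ℕ.* y →
  (+ k / d) * fromℤ (+ x) ≡ ½ * fromℤ (+ y)
/-*-halve k d@(suc _) x y eq = ℚ.toℚᵘ-injective (begin
  toℚᵘ ((+ k / d) * fromℤ (+ x))           ≈⟨ ℚ.toℚᵘ-homo-* (+ k / d) (fromℤ (+ x)) ⟩
  toℚᵘ (+ k / d) ℚᵘ.* toℚᵘ (fromℤ (+ x))   ≈⟨ ℚᵘ.*-congʳ (toℚᵘ-/ (+ k) d) ⟩
  (+ k ℚᵘ./ d) ℚᵘ.* toℚᵘ (fromℤ (+ x))     ≈⟨ *≡* cross ⟩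
  toℚᵘ ½ ℚᵘ.* toℚᵘ (fromℤ (+ y))           ≈⟨ ℚ.toℚᵘ-homo-* ½ (fromℤ (+ y)) ⟨
  toℚᵘ (½ * fromℤ (+ y))                   ∎)
  where
  open ℚᵘ.≃-Reasoning
  left : ∀ k x → k · x · + 2 ≡ + 2 · k · x
  left = ℤ-Solver.solve-∀
  right : ∀ d y → d · y ≡ + 1 · y · (d · + 1)
  right = ℤ-Solver.solve-∀
  push : ∀ a b c → + (a ℕ.* b ℕ.* c) ≡ + a · + b · + c
  push a b c = trans (ℤ.pos-* (a ℕ.* b) c) (cong (_· + c) (ℤ.pos-* a b))
  cross : + k · + x · + 2 ≡ + 1 · + y · + (d ℕ.* 1)
  cross = trans (left (+ k) (+ x)) (trans (sym (push 2 k x)) (trans (cong +_ eq)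
    (trans (ℤ.pos-* d y) (trans (right (+ d) (+ y)) (cong (+ 1 · + y ·_) (sym (ℤ.pos-* d 1)))))))

-- With k = i + 1, symmetry turns binom (n+k) (n-k) into binom (n+k) (2k), where `i < n` gives 2k ≤
-- n + k. Absorption then trades 2k for n + k.
weight-odd : ∀ n i .{{_ : NonZero n}} → i < n → weight n (suc i) ≡ ½ * fromℤ (odd n i)
weight-odd n i i<n = begin
  fromℤ p * (+ suc i / (n ℕ.+ suc i)) * fromℤ (+ x)
    ≡⟨ ℚ.*-assoc (fromℤ p) (+ suc i / (n ℕ.+ suc i)) (fromℤ (+ x)) ⟩
  fromℤ p * ((+ suc i / (n ℕ.+ suc i)) * fromℤ (+ x))
    ≡⟨ cong (fromℤ p *_) (/-*-halve (suc i) (n ℕ.+ suc i) x y absorb) ⟩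
  fromℤ p * (½ * fromℤ (+ y))                          ≡⟨ ℚ.*-assoc (fromℤ p) ½ (fromℤ (+ y)) ⟨
  fromℤ p * ½ * fromℤ (+ y)
    ≡⟨ cong (_* fromℤ (+ y)) (ℚ.*-comm (fromℤ p) ½) ⟩
  ½ * fromℤ p * fromℤ (+ y)                            ≡⟨ ℚ.*-assoc ½ (fromℤ p) (fromℤ (+ y)) ⟩
  ½ * (fromℤ p * fromℤ (+ y))                          ≡⟨ cong (½ *_) (fromℤ-* p (+ y)) ⟨
  ½ * fromℤ (odd n i)                                  ∎
  where
  open ≡-Reasoning
  instance _ = +-nonZeroˡ n (suc i)
  p = -2ℤ ^ (n ∸ suc i)
  x = (n ℕ.+ suc i) C (n ∸ suc i)
  y = (n ℕ.+ i) C suc (i ℕ.* 2)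
  2k≤n+k : suc i ℕ.* 2 ≤ n ℕ.+ suc i
  2k≤n+k = subst (_≤ n ℕ.+ suc i) (sym (k*2≡k+k (suc i))) (ℕ.+-monoˡ-≤ (suc i) i<n)
  complement : n ℕ.+ suc i ∸ suc i ℕ.* 2 ≡ n ∸ suc i
  complement = begin
    n ℕ.+ suc i ∸ suc i ℕ.* 2        ≡⟨ cong (n ℕ.+ suc i ∸_) (k*2≡k+k (suc i)) ⟩
    n ℕ.+ suc i ∸ (suc i ℕ.+ suc i)  ≡⟨ ℕ.∸-+-assoc (n ℕ.+ suc i) (suc i) (suc i) ⟨
    n ℕ.+ suc i ∸ suc i ∸ suc i      ≡⟨ cong (_∸ suc i) (ℕ.m+n∸n≡m n (suc i)) ⟩
    n ∸ suc i                        ∎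
  absorb : 2 ℕ.* suc i ℕ.* x ≡ (n ℕ.+ suc i) ℕ.* y
  absorb = begin
    2 ℕ.* suc i ℕ.* x                                     ≡⟨ cong (ℕ._* x) (ℕ.*-comm 2 (suc i)) ⟩
    suc i ℕ.* 2 ℕ.* ((n ℕ.+ suc i) C (n ∸ suc i))
      ≡⟨ cong (λ j → suc i ℕ.* 2 ℕ.* ((n ℕ.+ suc i) C j)) complement ⟨
    suc i ℕ.* 2 ℕ.* ((n ℕ.+ suc i) C (n ℕ.+ suc i ∸ suc i ℕ.* 2))
      ≡⟨ cong (suc i ℕ.* 2 ℕ.*_) (nCk≡nC[n∸k] 2k≤n+k) ⟨
    suc i ℕ.* 2 ℕ.* ((n ℕ.+ suc i) C (suc i ℕ.* 2))
      ≡⟨ cong (λ m → suc i ℕ.* 2 ℕ.* (m C (suc i ℕ.* 2))) (ℕ.+-suc n i) ⟩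
    suc i ℕ.* 2 ℕ.* (suc (n ℕ.+ i) C (suc i ℕ.* 2))
      ≡⟨ absorption (n ℕ.+ i) (suc (i ℕ.* 2)) ⟩
    suc (n ℕ.+ i) ℕ.* y                                   ≡⟨ cong (ℕ._* y) (ℕ.+-suc n i) ⟨
    (n ℕ.+ suc i) ℕ.* y                                   ∎

weightedSum : ∀ G n .{{_ : NonZero n}} t →
  (∑[1≤ k ≤ n ] (weight n k * fromℤ (G (+ 5 · + k + t)))) ≡ ½ * fromℤ (oddSum G n t)
weightedSum G n t = begin
  (∑[1≤ k ≤ n ] (weight n k * fromℤ (G (+ 5 · + k + t))))
    ≡⟨ ∑ℚ.sum-cong-≗ {n} (λ i → step (toℕ i) (toℕ<n i)) ⟩
  ∑ℚ.sum {n} (λ i → ½ * fromℤ (f (toℕ i)))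
    ≡⟨ ∑ℚ.*-distribˡ-sum {n} ½ (λ i → fromℤ (f (toℕ i))) ⟨
  ½ * ∑ℚ.sum {n} (λ i → fromℤ (f (toℕ i)))
    ≡⟨ cong (½ *_) (fromℤ-sumBelow n f) ⟨
  ½ * fromℤ (oddSum G n t) ∎
  where
  open ≡-Reasoning
  f : ℕ → ℤ
  f i = odd n i · G (+ 5 · + suc i + t)
  step : ∀ i → i < n → weight n (suc i) * fromℤ (G (+ 5 · + suc i + t)) ≡ ½ * fromℤ (f i)
  step i i<n = begin
    weight n (suc i) * fromℤ g          ≡⟨ cong (_* fromℤ g) (weight-odd n i i<n) ⟩
    ½ * fromℤ (odd n i) * fromℤ g       ≡⟨ ℚ.*-assoc ½ (fromℤ (odd n i)) (fromℤ g) ⟩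
    ½ * (fromℤ (odd n i) * fromℤ g)     ≡⟨ cong (½ *_) (fromℤ-* (odd n i) g) ⟨
    ½ * fromℤ (f i)                     ∎
    where g = G (+ 5 · + suc i + t)

theorem16 : (n : ℕ) .{{_ : NonZero n}} (t : ℤ) →
    ((∑[1≤ k ≤ n ] (weight n k * fromℤ (L (+ 5 · + k + t))))
    ≡ ½ * fromℤ ((+ 4) ^ n · F (t + + n + + 3) - F (t - + n + + 3)))
    ×
    ((∑[1≤ k ≤ n ] (weight n k * fromℤ (F (+ 5 · + k + t))))
    ≡ (+ 1 / 10) * fromℤ ((+ 4) ^ n · L (t + + n + + 3) - L (t - + n + + 3)))
theorem16 n t = lucasCase , fibonacciCase
  where
  open ≡-Reasoning
  module LF = ClosedForm {L} {F} (+ 1) F-gibonacci (λ m → trans (ℤ.*-identityˡ (L m)) (L-via-F m))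
  module FL = ClosedForm {F} {L} (+ 5) L-gibonacci 5F-via-L
  lucasCase = begin
    _                          ≡⟨ weightedSum L n t ⟩
    ½ * fromℤ (oddSum L n t)   ≡⟨ cong (λ z → ½ * fromℤ z) (ℤ.*-identityˡ (oddSum L n t)) ⟨
    ½ * fromℤ (+ 1 · oddSum L n t)
      ≡⟨ cong (λ z → ½ * fromℤ z) (proj₁ (LF.closedForm n t)) ⟩
    _                          ∎
  fibonacciCase = begin
    _                                                  ≡⟨ weightedSum F n t ⟩
    -- Here `½` is replaced by `(+ 1 / 10) * fromℤ (+ 5)`, equal by computation, to supply the
    -- factor c = 5 of the closed form.
    (+ 1 / 10) * fromℤ (+ 5) * fromℤ (oddSum F n t)
      ≡⟨ ℚ.*-assoc (+ 1 / 10) (fromℤ (+ 5)) (fromℤ (oddSum F n t)) ⟩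
    (+ 1 / 10) * (fromℤ (+ 5) * fromℤ (oddSum F n t))
      ≡⟨ cong ((+ 1 / 10) *_) (fromℤ-* (+ 5) (oddSum F n t)) ⟨
    (+ 1 / 10) * fromℤ (+ 5 · oddSum F n t)
      ≡⟨ cong (λ z → (+ 1 / 10) * fromℤ z) (proj₁ (FL.closedForm n t)) ⟩
    _                                                  ∎
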